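{- Let $\mathcal G\in\mathbb G^4_S$ have decomposition $\mathcal G=\mathcal G_{cpi}+\mathcal G_{cyclic}$, where $\mathcal G_{cpi}$ has edge weights $\omega_j+\omega_k$ and $\mathcal G_{cyclic}=u\,\mathbf b^4_{1,4,2,3}+v\,\mathbf b^4_{1,2,3,4}$, i.e. $\mathcal G_{cyclic}$ has weights $v$ on $\{V_1,V_2\},\{V_3,V_4\}$, $u-v$ on $\{V_2,V_3\},\{V_1,V_4\}$, and $-u$ on $\{V_1,V_3\},\{V_2,V_4\}$. Let $\omega=\min(\omega_1,\omega_2,\omega_3,\omega_4)$. Then $\mathcal G$ satisfies the triangle inequality ($d_{i,k}\le d_{i,j}+d_{j,k}$ for all distinct $i,j,k$) if and only if $\omega\ge-u$, $\omega\ge v$ and $\omega\ge u-v$. In particular, if some $\omega_j<0$ then $\mathcal G$ does not satisfy the triangle inequality.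
   Context: $\mathbb G^4_S$ is the space of complete undirected weighted graphs without loops on $V_1,\dots,V_4$ with edge weights $d_{i,j}=d_{j,i}$, identified with $\mathbb R^6$ with the standard inner product. $\mathcal G_{cpi}$ is the orthogonal projection onto the subspace of graphs with $d_{j,k}=\omega_j+\omega_k$ for some reals $\omega_j$, and $\mathcal G_{cyclic}=\mathcal G-\mathcal G_{cpi}$ lies in its orthogonal complement, which is spanned by $\mathbf b^4_{1,4,2,3}$ and $\mathbf b^4_{1,2,3,4}$; here $\mathbf b^4_{i,j,k,s}$ has $d_{i,j}=1,d_{j,k}=-1,d_{k,s}=1,d_{s,i}=-1$ and other entries 0. -}

module Defs where

open import Data.Bool using (Bool; if_then_else_; _∧_; _∨_)
open import Data.Bool.Properties using (∧-comm; ∨-comm)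
open import Data.Fin using (Fin; _≟_)
open import Data.Fin.Patterns using (0F; 1F; 2F; 3F)
open import Data.Nat as ℕ using (ℕ)
import Data.Nat.Properties as ℕ
open import Data.Product using (∃-syntax; _×_; _,_)
open import Data.Rational as ℚ using (ℚ; 0ℚ; 1ℚ; ½; ∣_∣; Positive)
import Data.Rational.Properties as ℚ
open import Data.Rational.Solver using (module +-*-Solver)
open import Data.Sum using (inj₁; inj₂)
open import Relation.Binary.PropositionalEquality using (_≡_; _≢_; refl; sym; trans; cong; cong₂; subst; subst₂)
open import Relation.Nullary.Decidable using (dec-true)
open import Relation.Nullary using (does; yes; no; contradiction)

infix  8 -_
infixl 7 _*_ _⊓_
infixl 6 _+_ _-_
infix  4 _≈_ _≤_ _≥_ _<_ _≋_

Eventually : (ℕ → Set) → Set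
Eventually P = ∃[ N ] (∀ n → N ℕ.≤ n → P n)

-- Quantification over all ε > 0 is over rational ε throughout.

Cauchy : (ℕ → ℚ) → Set
Cauchy x = ∀ ε → 0ℚ ℚ.< ε →
  ∃[ N ] (∀ m n → N ℕ.≤ m → N ℕ.≤ n → ∣ x m ℚ.- x n ∣ ℚ.< ε)

Close : (x y : ℕ → ℚ) → Set
Close x y = ∀ ε → 0ℚ ℚ.< ε → Eventually λ n → ∣ x n ℚ.- y n ∣ ℚ.< ε

-- The reals as Cauchy sequences of rationals, with equality _≈_ of limits.
record ℝ : Set where
  constructor mkℝ
  field
    seq    : ℕ → ℚ
    cauchy : Cauchy seq

open ℝ public

_≈_ _≤_ _≥_ _<_ : ℝ → ℝ → Set
x ≈ y = Close (seq x) (seq y)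
x ≤ y = ∀ ε → 0ℚ ℚ.< ε → Eventually λ n → seq x n ℚ.< seq y n ℚ.+ ε
x ≥ y = y ≤ x
x < y = ∃[ ε ] (0ℚ ℚ.< ε × Eventually λ n → seq x n ℚ.+ ε ℚ.< seq y n)

private
  module S = +-*-Solver
  open S using (_:+_; _:*_; _:-_; :-_; _:=_; con)

  ∧-eventually : ∀ {P Q R : ℕ → Set} → Eventually P → Eventually Q →
                 (∀ n → P n → Q n → R n) → Eventually R
  ∧-eventually (M , p) (N , q) r = M ℕ.⊔ N , λ n h →
    r n (p n (ℕ.≤-trans (ℕ.m≤m⊔n M N) h)) (q n (ℕ.≤-trans (ℕ.m≤n⊔m M N) h))

  ∧-cauchy : ∀ {P Q R : ℕ → ℕ → Set} →
             ∃[ N ] (∀ m n → N ℕ.≤ m → N ℕ.≤ n → P m n) →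
             ∃[ N ] (∀ m n → N ℕ.≤ m → N ℕ.≤ n → Q m n) →
             (∀ m n → P m n → Q m n → R m n) →
             ∃[ N ] (∀ m n → N ℕ.≤ m → N ℕ.≤ n → R m n)
  ∧-cauchy (M , p) (N , q) r = M ℕ.⊔ N , λ m n hm hn →
    r m n (p m n (ℕ.≤-trans (ℕ.m≤m⊔n M N) hm) (ℕ.≤-trans (ℕ.m≤m⊔n M N) hn))
          (q m n (ℕ.≤-trans (ℕ.m≤n⊔m M N) hm) (ℕ.≤-trans (ℕ.m≤n⊔m M N) hn))

  *-pos : ∀ {p q} → 0ℚ ℚ.< p → 0ℚ ℚ.< q → 0ℚ ℚ.< p ℚ.* q
  *-pos {p} {q} hp hq = ℚ.positive⁻¹ (p ℚ.* q)
    {{ℚ.pos*pos⇒pos p {{ℚ.positive hp}} q {{ℚ.positive hq}}}}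

  0<½ : 0ℚ ℚ.< ½
  0<½ = ℚ.positive⁻¹ ½

  half : ∀ {ε} → 0ℚ ℚ.< ε → 0ℚ ℚ.< ε ℚ.* ½
  half h = *-pos h 0<½

  half+half : ∀ ε → ε ℚ.* ½ ℚ.+ ε ℚ.* ½ ≡ ε
  half+half = S.solve 1 (λ e → e :* con ½ :+ e :* con ½ := e) refl

  p≤∣p∣ : ∀ p → p ℚ.≤ ∣ p ∣
  p≤∣p∣ p with ℚ.≤-total 0ℚ p
  ... | inj₁ h = ℚ.≤-reflexive (sym (ℚ.0≤p⇒∣p∣≡p h))
  ... | inj₂ h = ℚ.≤-trans h (ℚ.0≤∣p∣ p)

  ∣p-q∣≡∣q-p∣ : ∀ p q → ∣ p ℚ.- q ∣ ≡ ∣ q ℚ.- p ∣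
  ∣p-q∣≡∣q-p∣ p q = trans
    (cong ∣_∣ (S.solve 2 (λ p q → p :- q := :- (q :- p)) refl p q))
    (ℚ.∣-p∣≡∣p∣ (q ℚ.- p))

  ∣-∣<⇒<+ : ∀ {p q ε} → ∣ p ℚ.- q ∣ ℚ.< ε → p ℚ.< q ℚ.+ ε
  ∣-∣<⇒<+ {p} {q} {ε} h = subst (ℚ._< q ℚ.+ ε)
    (S.solve 2 (λ p q → q :+ (p :- q) := p) refl p q)
    (ℚ.+-monoʳ-< q (ℚ.≤-<-trans (p≤∣p∣ (p ℚ.- q)) h))

  <+⇒-< : ∀ {p q ε} → p ℚ.< q ℚ.+ ε → p ℚ.- q ℚ.< ε
  <+⇒-< {p} {q} {ε} h = subst (p ℚ.- q ℚ.<_)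
    (S.solve 2 (λ q e → q :+ e :- q := e) refl q ε)
    (ℚ.+-monoˡ-< (ℚ.- q) h)

  <+⇒∣-∣< : ∀ {p q ε} → p ℚ.< q ℚ.+ ε → q ℚ.< p ℚ.+ ε → ∣ p ℚ.- q ∣ ℚ.< ε
  <+⇒∣-∣< {p} {q} {ε} h k with ℚ.∣p∣≡p∨∣p∣≡-p (p ℚ.- q)
  ... | inj₁ e = subst (ℚ._< ε) (sym e) (<+⇒-< h)
  ... | inj₂ e = subst (ℚ._< ε)
    (sym (trans e (S.solve 2 (λ p q → :- (p :- q) := q :- p) refl p q))) (<+⇒-< k)

  +-close : ∀ {a a′ b b′ ε} → ∣ a ℚ.- a′ ∣ ℚ.< ε ℚ.* ½ → ∣ b ℚ.- b′ ∣ ℚ.< ε ℚ.* ½ →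
            ∣ (a ℚ.+ b) ℚ.- (a′ ℚ.+ b′) ∣ ℚ.< ε
  +-close {a} {a′} {b} {b′} {ε} h k =
    subst₂ ℚ._<_
      (cong ∣_∣ (S.solve 4 (λ a a′ b b′ → (a :- a′) :+ (b :- b′) := (a :+ b) :- (a′ :+ b′)) refl a a′ b b′))
      (half+half ε)
      (ℚ.≤-<-trans (ℚ.∣p+q∣≤∣p∣+∣q∣ (a ℚ.- a′) (b ℚ.- b′)) (ℚ.+-mono-< h k))

  neg-close : ∀ {a a′ ε} → ∣ a ℚ.- a′ ∣ ℚ.< ε → ∣ (ℚ.- a) ℚ.- (ℚ.- a′) ∣ ℚ.< ε
  neg-close {a} {a′} {ε} h = subst (ℚ._< ε)
    (trans (sym (ℚ.∣-p∣≡∣p∣ (a ℚ.- a′)))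
      (cong ∣_∣ (S.solve 2 (λ a a′ → :- (a :- a′) := (:- a) :- (:- a′)) refl a a′))) h

  ⊓-<+ : ∀ {a a′ b b′ ε} → a ℚ.< a′ ℚ.+ ε → b ℚ.< b′ ℚ.+ ε → a ℚ.⊓ b ℚ.< (a′ ℚ.⊓ b′) ℚ.+ ε
  ⊓-<+ {a} {a′} {b} {b′} {ε} h k with ℚ.⊓-sel a′ b′
  ... | inj₁ e = subst (λ z → a ℚ.⊓ b ℚ.< z ℚ.+ ε) (sym e) (ℚ.≤-<-trans (ℚ.p⊓q≤p a b) h)
  ... | inj₂ e = subst (λ z → a ℚ.⊓ b ℚ.< z ℚ.+ ε) (sym e) (ℚ.≤-<-trans (ℚ.p⊓q≤q a b) k)

  ⊓-close : ∀ {a a′ b b′ ε} → ∣ a ℚ.- a′ ∣ ℚ.< ε → ∣ b ℚ.- b′ ∣ ℚ.< ε →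
            ∣ (a ℚ.⊓ b) ℚ.- (a′ ℚ.⊓ b′) ∣ ℚ.< ε
  ⊓-close {a} {a′} {b} {b′} {ε} h k = <+⇒∣-∣< {a ℚ.⊓ b} {a′ ℚ.⊓ b′}
    (⊓-<+ {a} {a′} {b} {b′} (∣-∣<⇒<+ {a} {a′} h) (∣-∣<⇒<+ {b} {b′} k))
    (⊓-<+ {a′} {a} {b′} {b} (∣-∣<⇒<+ {a′} {a} (subst (ℚ._< ε) (∣p-q∣≡∣q-p∣ a a′) h))
                            (∣-∣<⇒<+ {b′} {b} (subst (ℚ._< ε) (∣p-q∣≡∣q-p∣ b b′) k)))

  Bound : (ℕ → ℚ) → Set
  Bound x = ∃[ K ] (0ℚ ℚ.< K × Eventually λ n → ∣ x n ∣ ℚ.< K)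

  bound : ∀ x → Bound (seq x)
  bound x with cauchy x 1ℚ (ℚ.positive⁻¹ 1ℚ)
  ... | N , h = ∣ a ∣ ℚ.+ 1ℚ
      , ℚ.<-≤-trans (ℚ.positive⁻¹ 1ℚ)
          (subst (ℚ._≤ ∣ a ∣ ℚ.+ 1ℚ) (ℚ.+-identityˡ 1ℚ) (ℚ.+-monoˡ-≤ 1ℚ (ℚ.0≤∣p∣ a)))
      , N , λ n N≤n → ℚ.≤-<-trans
          (subst (λ z → ∣ z ∣ ℚ.≤ ∣ a ∣ ℚ.+ ∣ seq x n ℚ.- a ∣)
             (S.solve 2 (λ a b → a :+ (b :- a) := b) refl a (seq x n))
             (ℚ.∣p+q∣≤∣p∣+∣q∣ a (seq x n ℚ.- a)))
          (ℚ.+-monoʳ-< ∣ a ∣ (h n N N≤n ℕ.≤-refl))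
    where a = seq x N

  module Divide (K : ℚ) (0<K : 0ℚ ℚ.< K) where
    instance
      pos : Positive K
      pos = ℚ.positive 0<K
      nz : ℚ.NonZero K
      nz = ℚ.pos⇒nonZero K
    inv : ℚ
    inv = ℚ.1/ K
    0<inv : 0ℚ ℚ.< inv
    0<inv = ℚ.positive⁻¹ inv {{ℚ.1/pos⇒pos K}}
    scaled : ∀ {p q e} → ∣ p ∣ ℚ.< K → ∣ q ∣ ℚ.< e ℚ.* inv → ∣ p ℚ.* q ∣ ℚ.< e
    scaled {p} {q} {e} hp hq = ℚ.≤-<-trans
      (subst (ℚ._≤ K ℚ.* ∣ q ∣) (sym (ℚ.∣p*q∣≡∣p∣*∣q∣ p q))
        (ℚ.*-monoʳ-≤-nonNeg ∣ q ∣ {{ℚ.∣-∣-nonNeg q}} (ℚ.<⇒≤ hp)))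
      (subst (K ℚ.* ∣ q ∣ ℚ.<_)
        (trans (S.solve 3 (λ k e i → k :* (e :* i) := e :* (i :* k)) refl K e inv)
          (trans (cong (e ℚ.*_) (ℚ.*-inverseˡ K)) (ℚ.*-identityʳ e)))
        (ℚ.*-monoʳ-<-pos K hq))

  split-* : ∀ {a a′ b b′ ε} → ∣ b′ ℚ.* (a ℚ.- a′) ∣ ℚ.< ε ℚ.* ½ → ∣ a ℚ.* (b ℚ.- b′) ∣ ℚ.< ε ℚ.* ½ →
            ∣ a ℚ.* b ℚ.- a′ ℚ.* b′ ∣ ℚ.< ε
  split-* {a} {a′} {b} {b′} {ε} h k =
    subst₂ ℚ._<_
      (cong ∣_∣ (S.solve 4 (λ a a′ b b′ → b′ :* (a :- a′) :+ a :* (b :- b′) := a :* b :- a′ :* b′) refl a a′ b b′))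
      (half+half ε)
      (ℚ.≤-<-trans (ℚ.∣p+q∣≤∣p∣+∣q∣ (b′ ℚ.* (a ℚ.- a′)) (a ℚ.* (b ℚ.- b′))) (ℚ.+-mono-< h k))

  abstract
    *-cauchy : ∀ x y → Cauchy (λ n → seq x n ℚ.* seq y n)
    *-cauchy x y ε 0<ε = helper (bound x) (bound y)
      where
        helper : Bound (seq x) → Bound (seq y) →
          ∃[ N ] (∀ m n → N ℕ.≤ m → N ℕ.≤ n → ∣ seq x m ℚ.* seq y m ℚ.- seq x n ℚ.* seq y n ∣ ℚ.< ε)
        helper (A , 0<A , Na , ha) (B , 0<B , Nb , hb) =
          ∧-cauchy fst snd λ m n → split-* {seq x m} {seq x n} {seq y m} {seq y n} {ε}
          where
            module DA = Divide A 0<A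
            module DB = Divide B 0<B
            fst : ∃[ N ] (∀ m n → N ℕ.≤ m → N ℕ.≤ n → ∣ seq y n ℚ.* (seq x m ℚ.- seq x n) ∣ ℚ.< ε ℚ.* ½)
            fst = ∧-cauchy (cauchy x (ε ℚ.* ½ ℚ.* DB.inv) (*-pos {ε ℚ.* ½} {DB.inv} (half {ε} 0<ε) DB.0<inv))
                    (Nb , λ m n _ hn → hb n hn)
                    (λ m n p q → DB.scaled {seq y n} {seq x m ℚ.- seq x n} {ε ℚ.* ½} q p)
            snd : ∃[ N ] (∀ m n → N ℕ.≤ m → N ℕ.≤ n → ∣ seq x m ℚ.* (seq y m ℚ.- seq y n) ∣ ℚ.< ε ℚ.* ½)
            snd = ∧-cauchy (cauchy y (ε ℚ.* ½ ℚ.* DA.inv) (*-pos {ε ℚ.* ½} {DA.inv} (half {ε} 0<ε) DA.0<inv))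
                    (Na , λ m n hm _ → ha m hm)
                    (λ m n p q → DA.scaled {seq x m} {seq y m ℚ.- seq y n} {ε ℚ.* ½} q p)

fromℚ : ℚ → ℝ
fromℚ q = mkℝ (λ _ → q) λ ε 0<ε → 0 , λ _ _ _ _ → subst (ℚ._< ε) (sym (cong ∣_∣ (ℚ.+-inverseʳ q))) 0<ε

0ℝ 1ℝ : ℝ
0ℝ = fromℚ 0ℚ
1ℝ = fromℚ 1ℚ

_+_ _*_ _⊓_ : ℝ → ℝ → ℝ

x + y = mkℝ (λ n → seq x n ℚ.+ seq y n) λ ε 0<ε →
  ∧-cauchy (cauchy x (ε ℚ.* ½) (half 0<ε)) (cauchy y (ε ℚ.* ½) (half 0<ε))
    λ m n → +-close {seq x m} {seq x n} {seq y m} {seq y n} {ε}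

-_ : ℝ → ℝ
- x = mkℝ (λ n → ℚ.- seq x n) λ ε 0<ε →
  ∧-cauchy (cauchy x ε 0<ε) (cauchy x ε 0<ε) λ m n h _ → neg-close {seq x m} {seq x n} h

_-_ : ℝ → ℝ → ℝ
x - y = x + - y

x * y = mkℝ (λ n → seq x n ℚ.* seq y n) (*-cauchy x y)

x ⊓ y = mkℝ (λ n → seq x n ℚ.⊓ seq y n) λ ε 0<ε →
  ∧-cauchy (cauchy x ε 0<ε) (cauchy y ε 0<ε)
    λ m n → ⊓-close {seq x m} {seq x n} {seq y m} {seq y n}

≈-pointwise : ∀ {x y} → (∀ n → seq x n ≡ seq y n) → x ≈ y
≈-pointwise {x} {y} h ε 0<ε = 0 , λ n _ → subst (ℚ._< ε)
  (sym (cong ∣_∣ (trans (cong (ℚ._- seq y n) (h n)) (ℚ.+-inverseʳ (seq y n))))) 0<ε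

≈-refl : ∀ {x} → x ≈ x
≈-refl {x} = ≈-pointwise {x} {x} λ _ → refl

+-cong : ∀ {x x′ y y′} → x ≈ x′ → y ≈ y′ → x + y ≈ x′ + y′
+-cong {x} {x′} {y} {y′} p q ε 0<ε = ∧-eventually (p (ε ℚ.* ½) (half 0<ε)) (q (ε ℚ.* ½) (half 0<ε))
  λ n → +-close {seq x n} {seq x′ n} {seq y n} {seq y′ n} {ε}

-‿cong : ∀ {x x′} → x ≈ x′ → - x ≈ - x′
-‿cong {x} {x′} p ε 0<ε = ∧-eventually (p ε 0<ε) (p ε 0<ε)
  λ n h _ → neg-close {seq x n} {seq x′ n} h

abstract
  *-cong : ∀ {x x′ y y′} → x ≈ x′ → y ≈ y′ → x * y ≈ x′ * y′
  *-cong {x} {x′} {y} {y′} p q ε 0<ε = helper (bound x) (bound y′)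
    where
      helper : Bound (seq x) → Bound (seq y′) →
        Eventually λ n → ∣ seq x n ℚ.* seq y n ℚ.- seq x′ n ℚ.* seq y′ n ∣ ℚ.< ε
      helper (A , 0<A , ha) (B , 0<B , hb) =
        ∧-eventually fst snd λ n → split-* {seq x n} {seq x′ n} {seq y n} {seq y′ n} {ε}
        where
          module DA = Divide A 0<A
          module DB = Divide B 0<B
          fst : Eventually λ n → ∣ seq y′ n ℚ.* (seq x n ℚ.- seq x′ n) ∣ ℚ.< ε ℚ.* ½
          fst = ∧-eventually (p (ε ℚ.* ½ ℚ.* DB.inv) (*-pos {ε ℚ.* ½} {DB.inv} (half {ε} 0<ε) DB.0<inv)) hb
                  λ n h k → DB.scaled {seq y′ n} {seq x n ℚ.- seq x′ n} {ε ℚ.* ½} k h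
          snd : Eventually λ n → ∣ seq x n ℚ.* (seq y n ℚ.- seq y′ n) ∣ ℚ.< ε ℚ.* ½
          snd = ∧-eventually (q (ε ℚ.* ½ ℚ.* DA.inv) (*-pos {ε ℚ.* ½} {DA.inv} (half {ε} 0<ε) DA.0<inv)) ha
                  λ n h k → DA.scaled {seq x n} {seq y n ℚ.- seq y′ n} {ε ℚ.* ½} k h

V₁ V₂ V₃ V₄ : Fin 4
V₁ = 0F
V₂ = 1F
V₃ = 2F
V₄ = 3F

-- A loopless complete weighted graph on V₁, …, V₄; the absent loops are
-- recorded as zero diagonal entries, so that only the six weights d i j = d j i
-- with i ≢ j carry information.
record Graph : Set where
  field
    d      : Fin 4 → Fin 4 → ℝ
    d-sym  : ∀ i j → d i j ≈ d j i
    d-loop : ∀ i → d i i ≈ 0ℝ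

open Graph public

_≋_ : Graph → Graph → Set
G ≋ H = ∀ i j → d G i j ≈ d H i j

infixl 6 _+ᴳ_ _-ᴳ_
infixl 7 _·ᴳ_

_+ᴳ_ _-ᴳ_ : Graph → Graph → Graph
G +ᴳ H = record
  { d      = λ i j → d G i j + d H i j
  ; d-sym  = λ i j → +-cong {d G i j} {d G j i} {d H i j} {d H j i} (d-sym G i j) (d-sym H i j)
  ; d-loop = λ i → +-cong {d G i i} {0ℝ} {d H i i} {0ℝ} (d-loop G i) (d-loop H i)
  }
G -ᴳ H = record
  { d      = λ i j → d G i j - d H i j
  ; d-sym  = λ i j → +-cong {d G i j} {d G j i} { - d H i j} { - d H j i} (d-sym G i j)
                       (-‿cong {d H i j} {d H j i} (d-sym H i j))
  ; d-loop = λ i → +-cong {d G i i} {0ℝ} { - d H i i} { - 0ℝ} (d-loop G i)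
                     (-‿cong {d H i i} {0ℝ} (d-loop H i))
  }

_·ᴳ_ : ℝ → Graph → Graph
c ·ᴳ G = record
  { d      = λ i j → c * d G i j
  ; d-sym  = λ i j → *-cong {c} {c} {d G i j} {d G j i} (≈-refl {c}) (d-sym G i j)
  ; d-loop = loop
  }
  where
    loop : ∀ i → c * d G i i ≈ 0ℝ
    loop i ε 0<ε = ∧-eventually c*d≈c*0 c*d≈c*0
      λ n h _ → subst (λ z → ∣ seq c n ℚ.* seq (d G i i) n ℚ.- z ∣ ℚ.< ε) (ℚ.*-zeroʳ (seq c n)) h
      where
        c*d≈c*0 : Eventually λ n → ∣ seq c n ℚ.* seq (d G i i) n ℚ.- seq c n ℚ.* 0ℚ ∣ ℚ.< ε
        c*d≈c*0 = *-cong {c} {c} {d G i i} {0ℝ} (≈-refl {c}) (d-loop G i) ε 0<ε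

-- The inner product of ℝ⁶, one summand per edge.
⟨_,_⟩ : Graph → Graph → ℝ
⟨ G , H ⟩ = edge V₁ V₂ + edge V₁ V₃ + edge V₁ V₄ + edge V₂ V₃ + edge V₂ V₄ + edge V₃ V₄
  where
    edge : Fin 4 → Fin 4 → ℝ
    edge i j = d G i j * d H i j

HasVertexWeights : Graph → (Fin 4 → ℝ) → Set
HasVertexWeights G ω = ∀ j k → j ≢ k → d G j k ≈ ω j + ω k

IsCPI : Graph → Set
IsCPI G = ∃[ ω ] HasVertexWeights G ω

IsOrthogonalProjection : (Graph → Set) → Graph → Graph → Set
IsOrthogonalProjection W G P = W P × (∀ H → W H → ⟨ G -ᴳ P , H ⟩ ≈ 0ℝ)

isPair : (i j p q : Fin 4) → Bool
isPair i j p q = (does (p ≟ i) ∧ does (q ≟ j)) ∨ (does (p ≟ j) ∧ does (q ≟ i))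

-- For pairwise distinct i, j, k, s (the only case in which it is meaningful)
-- this is the graph b⁴ᵢⱼₖₛ.
𝐛 : (i j k s : Fin 4) → Graph
𝐛 i j k s = record
  { d      = weight
  ; d-sym  = λ p q → ≈-pointwise {weight p q} {weight q p} λ n → cong (λ w → seq w n) (weight-sym p q)
  ; d-loop = λ p → ≈-pointwise {weight p p} {0ℝ} λ n → cong (λ w → seq w n) (weight-loop p)
  }
  where
    entry : Fin 4 → Fin 4 → ℝ
    entry p q =
      if isPair i j p q then 1ℝ else
      if isPair j k p q then - 1ℝ else
      if isPair k s p q then 1ℝ else
      if isPair s i p q then - 1ℝ else 0ℝ

    weight : Fin 4 → Fin 4 → ℝ
    weight p q = if does (p ≟ q) then 0ℝ else entry p q

    isPair-sym : ∀ i j p q → isPair i j p q ≡ isPair i j q p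
    isPair-sym i j p q = trans (∨-comm (does (p ≟ i) ∧ does (q ≟ j)) _)
      (cong₂ _∨_ (∧-comm (does (p ≟ j)) _) (∧-comm (does (p ≟ i)) _))

    if-cong : ∀ {b b′} {x y y′ : ℝ} → b ≡ b′ → y ≡ y′ → (if b then x else y) ≡ (if b′ then x else y′)
    if-cong refl refl = refl

    entry-sym : ∀ p q → entry p q ≡ entry q p
    entry-sym p q =
      if-cong (isPair-sym i j p q) (if-cong (isPair-sym j k p q)
        (if-cong (isPair-sym k s p q) (if-cong (isPair-sym s i p q) refl)))

    does-sym : ∀ (p q : Fin 4) → does (p ≟ q) ≡ does (q ≟ p)
    does-sym p q with p ≟ q | q ≟ p
    ... | yes _ | yes _ = refl
    ... | no  _ | no  _ = refl
    ... | yes e | no ne = contradiction (sym e) ne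
    ... | no ne | yes e = contradiction (sym e) ne

    weight-sym : ∀ p q → weight p q ≡ weight q p
    weight-sym p q = if-cong (does-sym p q) (entry-sym p q)

    weight-loop : ∀ p → weight p p ≡ 0ℝ
    weight-loop p = cong (if_then 0ℝ else entry p p) (dec-true (p ≟ p) refl)

cyclicGraph : (u v : ℝ) → Graph
cyclicGraph u v = u ·ᴳ 𝐛 V₁ V₄ V₂ V₃ +ᴳ v ·ᴳ 𝐛 V₁ V₂ V₃ V₄

cyclicGraph-weights : ∀ u v → let D = d (cyclicGraph u v) in
  (D V₁ V₂ ≈ v × D V₃ V₄ ≈ v) ×
  (D V₂ V₃ ≈ u - v × D V₁ V₄ ≈ u - v) ×
  (D V₁ V₃ ≈ - u × D V₂ V₄ ≈ - u)
cyclicGraph-weights u v =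
  (pt V₁ V₂ v onV , pt V₃ V₄ v onV) ,
  (pt V₂ V₃ (u - v) onUV , pt V₁ V₄ (u - v) onUV) ,
  (pt V₁ V₃ (- u) onU , pt V₂ V₄ (- u) onU)
  where
    pt : ∀ i j z → (∀ n → seq (d (cyclicGraph u v) i j) n ≡ seq z n) → d (cyclicGraph u v) i j ≈ z
    pt i j z = ≈-pointwise {d (cyclicGraph u v) i j} {z}
    onV : ∀ n → seq u n ℚ.* 0ℚ ℚ.+ seq v n ℚ.* 1ℚ ≡ seq v n
    onV n = S.solve 2 (λ u v → u :* con 0ℚ :+ v :* con 1ℚ := v) refl (seq u n) (seq v n)
    onUV : ∀ n → seq u n ℚ.* 1ℚ ℚ.+ seq v n ℚ.* (ℚ.- 1ℚ) ≡ seq u n ℚ.- seq v n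
    onUV n = S.solve 2 (λ u v → u :* con 1ℚ :+ v :* con (ℚ.- 1ℚ) := u :- v) refl (seq u n) (seq v n)
    onU : ∀ n → seq u n ℚ.* (ℚ.- 1ℚ) ℚ.+ seq v n ℚ.* 0ℚ ≡ ℚ.- seq u n
    onU n = S.solve 2 (λ u v → u :* con (ℚ.- 1ℚ) :+ v :* con 0ℚ := :- u) refl (seq u n) (seq v n)

TriangleInequality : Graph → Set
TriangleInequality G = ∀ i j k → i ≢ j → j ≢ k → i ≢ k → d G i k ≤ d G i j + d G j k

min₄ : (Fin 4 → ℝ) → ℝ
min₄ ω = ω V₁ ⊓ ω V₂ ⊓ ω V₃ ⊓ ω V₄

{-# OPTIONS --safe #-}

-- Write d i j = ω i + ω j + c i j.  The three edges of a triangle lie in the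
-- three different perfect matchings of the vertex set, on which c takes the
-- values v, u − v and − u, so c sums to zero over every triangle.  Hence
-- d i k ≤ d i j + d j k says exactly that c i k ≤ ω j.  Every vertex is missed by
-- an edge of each matching, so each ω j has to dominate all three values; as
-- these sum to zero, ω j is then nonnegative.

module Submission where

open import Defs
open import Data.Fin using (Fin)
open import Data.Fin.Patterns using (0F; 1F; 2F; 3F)
import Data.Fin.Properties as Fin
open import Data.Nat as ℕ using (ℕ)
import Data.Nat.Properties as ℕ
open import Data.Product using (_×_; _,_; ∃-syntax)
open import Data.Rational as ℚ using (0ℚ; ½; ∣_∣)
import Data.Rational.Properties as ℚ
open import Data.Rational.Solver using (module +-*-Solver)
open import Data.Sum using (inj₁; inj₂)
open import Function.Base using (_∘_)
open import Function.Bundles using (_⇔_; mk⇔; module Equivalence)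
open import Relation.Binary.Bundles using (Preorder)
open import Relation.Binary.PropositionalEquality using (_≡_; _≢_; refl; sym; trans; cong; cong₂; subst; subst₂)
open import Relation.Nullary using (¬_; contradiction)
open import Relation.Nullary.Decidable using (toWitness; ¬?; _→-dec_)

open +-*-Solver using (solve; _:+_; _:*_; _:-_; :-_; _:=_; con)

private
  variable
    P Q R : ℕ → Set

-- Rational inequalities

0<ε/2 : ∀ {ε} → 0ℚ ℚ.< ε → 0ℚ ℚ.< ε ℚ.* ½
0<ε/2 {ε} 0<ε = subst (ℚ._< ε ℚ.* ½) (ℚ.*-zeroˡ ½) (ℚ.*-monoˡ-<-pos ½ 0<ε)

ε/2+ε/2≡ε : ∀ ε → ε ℚ.* ½ ℚ.+ ε ℚ.* ½ ≡ ε
ε/2+ε/2≡ε = solve 1 (λ e → e :* con ½ :+ e :* con ½ := e) refl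

p<p+ε : ∀ p {ε} → 0ℚ ℚ.< ε → p ℚ.< p ℚ.+ ε
p<p+ε p {ε} 0<ε = subst (ℚ._< p ℚ.+ ε) (ℚ.+-identityʳ p) (ℚ.+-monoʳ-< p 0<ε)

p≤∣p∣ : ∀ p → p ℚ.≤ ∣ p ∣
p≤∣p∣ p with ℚ.≤-total 0ℚ p
... | inj₁ 0≤p = ℚ.≤-reflexive (sym (ℚ.0≤p⇒∣p∣≡p 0≤p))
... | inj₂ p≤0 = ℚ.≤-trans p≤0 (ℚ.0≤∣p∣ p)

∣p-q∣<ε⇒p<q+ε : ∀ p q {ε} → ∣ p ℚ.- q ∣ ℚ.< ε → p ℚ.< q ℚ.+ ε
∣p-q∣<ε⇒p<q+ε p q {ε} h = subst (ℚ._< q ℚ.+ ε)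
  (solve 2 (λ p q → q :+ (p :- q) := p) refl p q)
  (ℚ.+-monoʳ-< q (ℚ.≤-<-trans (p≤∣p∣ (p ℚ.- q)) h))

-- Order on the reals

eventually-map₂ : (∀ n → P n → Q n → R n) → Eventually P → Eventually Q → Eventually R
eventually-map₂ f (M , p) (N , q) = M ℕ.⊔ N , λ n h →
  f n (p n (ℕ.≤-trans (ℕ.m≤m⊔n M N) h)) (q n (ℕ.≤-trans (ℕ.m≤n⊔m M N) h))

eventually-map : (∀ n → P n → R n) → Eventually P → Eventually R
eventually-map f (N , p) = N , λ n h → f n (p n h)

-- The reals are explicit arguments here and below because `_≈_` and `_≤_` unfold to statements
-- about `seq`, from which the Cauchy proofs cannot be recovered by unification.
≈-sym : ∀ x y → x ≈ y → y ≈ x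
≈-sym x y x≈y ε 0<ε = eventually-map
  (λ n → subst (ℚ._< ε) (trans (sym (ℚ.∣-p∣≡∣p∣ (seq x n ℚ.- seq y n)))
    (cong ∣_∣ (solve 2 (λ x y → :- (x :- y) := y :- x) refl (seq x n) (seq y n)))))
  (x≈y ε 0<ε)

≈-trans : ∀ x y z → x ≈ y → y ≈ z → x ≈ z
≈-trans x y z x≈y y≈z ε 0<ε = eventually-map₂
  (λ n p q → subst₂ ℚ._<_
    (cong ∣_∣ (solve 3 (λ x y z → (x :- y) :+ (y :- z) := x :- z) refl (seq x n) (seq y n) (seq z n)))
    (ε/2+ε/2≡ε ε)
    (ℚ.≤-<-trans (ℚ.∣p+q∣≤∣p∣+∣q∣ (seq x n ℚ.- seq y n) (seq y n ℚ.- seq z n)) (ℚ.+-mono-< p q)))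
  (x≈y (ε ℚ.* ½) (0<ε/2 0<ε)) (y≈z (ε ℚ.* ½) (0<ε/2 0<ε))

≈⇒≤ : ∀ x y → x ≈ y → x ≤ y
≈⇒≤ x y x≈y ε 0<ε = eventually-map (λ n → ∣p-q∣<ε⇒p<q+ε (seq x n) (seq y n)) (x≈y ε 0<ε)

≤-trans : ∀ x y z → x ≤ y → y ≤ z → x ≤ z
≤-trans x y z x≤y y≤z ε 0<ε = eventually-map₂
  (λ n p q → subst (seq x n ℚ.<_)
    (trans (ℚ.+-assoc (seq z n) (ε ℚ.* ½) (ε ℚ.* ½)) (cong (seq z n ℚ.+_) (ε/2+ε/2≡ε ε)))
    (ℚ.<-trans p (ℚ.+-monoˡ-< (ε ℚ.* ½) q)))
  (x≤y (ε ℚ.* ½) (0<ε/2 0<ε)) (y≤z (ε ℚ.* ½) (0<ε/2 0<ε))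

≤-preorder : Preorder _ _ _
≤-preorder = record
  { Carrier = ℝ
  ; _≈_ = _≈_
  ; _≲_ = _≤_
  ; isPreorder = record
    { isEquivalence = record
      { refl  = λ {x} → ≈-refl {x}
      ; sym   = λ {x} {y} → ≈-sym x y
      ; trans = λ {x} {y} {z} → ≈-trans x y z
      }
    ; reflexive = λ {x} {y} → ≈⇒≤ x y
    ; trans = λ {x} {y} {z} → ≤-trans x y z
    }
  }

open import Relation.Binary.Reasoning.Preorder ≤-preorder

≤-pointwise : ∀ x y → (∀ n → seq x n ℚ.≤ seq y n) → x ≤ y
≤-pointwise x y h ε 0<ε = 0 , λ n _ → ℚ.≤-<-trans (h n) (p<p+ε (seq y n) 0<ε)

+-mono-≤ : ∀ x x′ y y′ → x ≤ x′ → y ≤ y′ → x + y ≤ x′ + y′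
+-mono-≤ x x′ y y′ x≤x′ y≤y′ ε 0<ε = eventually-map₂
  (λ n p q → subst (seq x n ℚ.+ seq y n ℚ.<_)
    (trans (solve 3 (λ a b e → (a :+ e) :+ (b :+ e) := (a :+ b) :+ (e :+ e)) refl
             (seq x′ n) (seq y′ n) (ε ℚ.* ½))
           (cong (seq x′ n ℚ.+ seq y′ n ℚ.+_) (ε/2+ε/2≡ε ε)))
    (ℚ.+-mono-< p q))
  (x≤x′ (ε ℚ.* ½) (0<ε/2 0<ε)) (y≤y′ (ε ℚ.* ½) (0<ε/2 0<ε))

-- The hypothesis is taken at tolerance `ε + ε`: at an index where `y + ε` were at most `x`, adding
-- that inequality to itself would contradict it.
double-cancel-≤ : ∀ x y → x + x ≤ y + y → x ≤ y
double-cancel-≤ x y x+x≤y+y ε 0<ε = eventually-map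
  (λ n p → ℚ.≰⇒> λ q → ℚ.<-irrefl refl (ℚ.<-≤-trans p (subst (ℚ._≤ seq x n ℚ.+ seq x n)
    (solve 2 (λ y e → (y :+ e) :+ (y :+ e) := (y :+ y) :+ (e :+ e)) refl (seq y n) ε)
    (ℚ.+-mono-≤ q q))))
  (x+x≤y+y (ε ℚ.+ ε) (ℚ.<-trans 0<ε (p<p+ε ε 0<ε)))

-- An inequality depends only on the difference of its sides, so `x′ - x` may be added to both. The
-- differences are compared termwise, which lets ring identities over the rationals serve as the
-- hypothesis.
≤-resp-difference : ∀ x y x′ y′ → (∀ n → seq (y - x) n ≡ seq (y′ - x′) n) → x ≤ y → x′ ≤ y′
≤-resp-difference x y x′ y′ h x≤y ε 0<ε = eventually-map
  (λ n p → subst₂ ℚ._<_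
    (solve 2 (λ x x′ → x :+ (x′ :- x) := x′) refl (seq x n) (seq x′ n))
    (trans (solve 4 (λ x y x′ e → (y :+ e) :+ (x′ :- x) := (y :- x) :+ (x′ :+ e)) refl
             (seq x n) (seq y n) (seq x′ n) ε)
      (trans (cong (ℚ._+ (seq x′ n ℚ.+ ε)) (h n))
        (solve 3 (λ x′ y′ e → (y′ :- x′) :+ (x′ :+ e) := y′ :+ e) refl (seq x′ n) (seq y′ n) ε)))
    (ℚ.+-monoˡ-< (seq x′ n ℚ.- seq x n) p))
  (x≤y ε 0<ε)

-- At the gap `ε` that witnesses strictness, the two eventual bounds contradict each other at every
-- late index, in particular at the threshold `N` itself.
≤⇒≯ : ∀ x y → x ≤ y → ¬ (y < x)
≤⇒≯ x y x≤y (ε , 0<ε , y<x)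
  with N , absurd ← eventually-map₂ (λ n p q → ℚ.<-irrefl refl (ℚ.<-trans p q)) (x≤y ε 0<ε) y<x
  = absurd N ℕ.≤-refl

-- If `w + ε` were nonpositive at a late index, all three summands would be negative there and could
-- not sum to zero. The case distinction is on rationals, so no sign of a real has to be decided.
upper-bound-of-zero-sum : ∀ x y z w → (∀ n → seq (x + y + z) n ≡ 0ℚ) →
  x ≤ w → y ≤ w → z ≤ w → 0ℝ ≤ w
upper-bound-of-zero-sum x y z w sum≡0 x≤w y≤w z≤w ε 0<ε = eventually-map₂
  (λ n (p , q) r → ℚ.≰⇒> λ w+ε≤0 → ℚ.<-irrefl (sum≡0 n)
    (ℚ.+-mono-< (ℚ.+-mono-< (ℚ.<-≤-trans p w+ε≤0) (ℚ.<-≤-trans q w+ε≤0)) (ℚ.<-≤-trans r w+ε≤0)))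
  (eventually-map₂ (λ _ → _,_) (x≤w ε 0<ε) (y≤w ε 0<ε))
  (z≤w ε 0<ε)

-- Minima of reals

⊓-glb : ∀ x y z → x ≤ y → x ≤ z → x ≤ y ⊓ z
⊓-glb x y z x≤y x≤z ε 0<ε = eventually-map₂ (λ n → below n (ℚ.⊓-sel (seq y n) (seq z n)))
  (x≤y ε 0<ε) (x≤z ε 0<ε)
  where
    -- Which argument attains the rational minimum may change with the index, so it is selected
    -- separately at each `n`.
    below : ∀ n → _ → seq x n ℚ.< seq y n ℚ.+ ε → seq x n ℚ.< seq z n ℚ.+ ε →
            seq x n ℚ.< seq (y ⊓ z) n ℚ.+ ε
    below n (inj₁ e) p _ = subst (λ m → seq x n ℚ.< m ℚ.+ ε) (sym e) p
    below n (inj₂ e) _ q = subst (λ m → seq x n ℚ.< m ℚ.+ ε) (sym e) q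

x⊓y≤x : ∀ x y → x ⊓ y ≤ x
x⊓y≤x x y = ≤-pointwise (x ⊓ y) x λ n → ℚ.p⊓q≤p (seq x n) (seq y n)

x⊓y≤y : ∀ x y → x ⊓ y ≤ y
x⊓y≤y x y = ≤-pointwise (x ⊓ y) y λ n → ℚ.p⊓q≤q (seq x n) (seq y n)

min₄-glb : ∀ ω x → (∀ j → x ≤ ω j) → x ≤ min₄ ω
min₄-glb ω x h =
  ⊓-glb x (ω V₁ ⊓ ω V₂ ⊓ ω V₃) (ω V₄)
    (⊓-glb x (ω V₁ ⊓ ω V₂) (ω V₃) (⊓-glb x (ω V₁) (ω V₂) (h V₁) (h V₂)) (h V₃))
    (h V₄)

min₄≤ : ∀ ω j → min₄ ω ≤ ω j
min₄≤ ω 0F = begin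
  min₄ ω              ≲⟨ x⊓y≤x (ω V₁ ⊓ ω V₂ ⊓ ω V₃) (ω V₄) ⟩
  ω V₁ ⊓ ω V₂ ⊓ ω V₃  ≲⟨ x⊓y≤x (ω V₁ ⊓ ω V₂) (ω V₃) ⟩
  ω V₁ ⊓ ω V₂         ≲⟨ x⊓y≤x (ω V₁) (ω V₂) ⟩
  ω V₁                ∎
min₄≤ ω 1F = begin
  min₄ ω              ≲⟨ x⊓y≤x (ω V₁ ⊓ ω V₂ ⊓ ω V₃) (ω V₄) ⟩
  ω V₁ ⊓ ω V₂ ⊓ ω V₃  ≲⟨ x⊓y≤x (ω V₁ ⊓ ω V₂) (ω V₃) ⟩
  ω V₁ ⊓ ω V₂         ≲⟨ x⊓y≤y (ω V₁) (ω V₂) ⟩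
  ω V₂                ∎
min₄≤ ω 2F = begin
  min₄ ω              ≲⟨ x⊓y≤x (ω V₁ ⊓ ω V₂ ⊓ ω V₃) (ω V₄) ⟩
  ω V₁ ⊓ ω V₂ ⊓ ω V₃  ≲⟨ x⊓y≤y (ω V₁ ⊓ ω V₂) (ω V₃) ⟩
  ω V₃                ∎
min₄≤ ω 3F = x⊓y≤y (ω V₁ ⊓ ω V₂ ⊓ ω V₃) (ω V₄)

-- The cyclic part

-- Termwise equality is stronger than `_≈_`; it allows the sums to be rewritten inside rational
-- identities.
TriangleSumsVanish : Graph → Set
TriangleSumsVanish H = ∀ i j k → i ≢ j → j ≢ k → i ≢ k →
  ∀ n → seq (d H i j + d H j k + d H i k) n ≡ 0ℚ

𝐛₁₄₂₃-triangleSum : TriangleSumsVanish (𝐛 V₁ V₄ V₂ V₃)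
𝐛₁₄₂₃-triangleSum i j k i≢j j≢k i≢k n =
  -- The weights are constant sequences with values 0, 1 and -1, so the claim does not vary with `n`
  -- and is decided by evaluation over all triples of vertices.
  toWitness {a? = Fin.all? λ i → Fin.all? λ j → Fin.all? λ k →
    ¬? (i Fin.≟ j) →-dec ¬? (j Fin.≟ k) →-dec ¬? (i Fin.≟ k) →-dec
    (seq (d b i j + d b j k + d b i k) n ℚ.≟ 0ℚ)} _ i j k i≢j j≢k i≢k
  where b = 𝐛 V₁ V₄ V₂ V₃

𝐛₁₂₃₄-triangleSum : TriangleSumsVanish (𝐛 V₁ V₂ V₃ V₄)
𝐛₁₂₃₄-triangleSum i j k i≢j j≢k i≢k n =
  toWitness {a? = Fin.all? λ i → Fin.all? λ j → Fin.all? λ k →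
    ¬? (i Fin.≟ j) →-dec ¬? (j Fin.≟ k) →-dec ¬? (i Fin.≟ k) →-dec
    (seq (d b i j + d b j k + d b i k) n ℚ.≟ 0ℚ)} _ i j k i≢j j≢k i≢k
  where b = 𝐛 V₁ V₂ V₃ V₄

combination-triangleSum : ∀ u v G H → TriangleSumsVanish G → TriangleSumsVanish H →
  TriangleSumsVanish (u ·ᴳ G +ᴳ v ·ᴳ H)
combination-triangleSum u v G H sumG sumH i j k i≢j j≢k i≢k n = trans
  (regroup (seq u n) (seq v n)
    (seq (d G i j) n) (seq (d G j k) n) (seq (d G i k) n)
    (seq (d H i j) n) (seq (d H j k) n) (seq (d H i k) n))
  (trans (cong₂ (λ s t → seq u n ℚ.* s ℚ.+ seq v n ℚ.* t)
           (sumG i j k i≢j j≢k i≢k n) (sumH i j k i≢j j≢k i≢k n))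
    (cong₂ ℚ._+_ (ℚ.*-zeroʳ (seq u n)) (ℚ.*-zeroʳ (seq v n))))
  where
    regroup : ∀ u v a b c p q r →
      (u ℚ.* a ℚ.+ v ℚ.* p) ℚ.+ (u ℚ.* b ℚ.+ v ℚ.* q) ℚ.+ (u ℚ.* c ℚ.+ v ℚ.* r) ≡
      u ℚ.* (a ℚ.+ b ℚ.+ c) ℚ.+ v ℚ.* (p ℚ.+ q ℚ.+ r)
    regroup = solve 8 (λ u v a b c p q r →
      (u :* a :+ v :* p) :+ (u :* b :+ v :* q) :+ (u :* c :+ v :* r) :=
      u :* (a :+ b :+ c) :+ v :* (p :+ q :+ r)) refl

cyclicGraph-triangleSum : ∀ u v → TriangleSumsVanish (cyclicGraph u v)
cyclicGraph-triangleSum u v =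
  combination-triangleSum u v (𝐛 V₁ V₄ V₂ V₃) (𝐛 V₁ V₂ V₃ V₄) 𝐛₁₄₂₃-triangleSum 𝐛₁₂₃₄-triangleSum

-- Bounds on the three perfect matchings

AllMatchings≤ : (u v x : ℝ) → Set
AllMatchings≤ u v x = - u ≤ x × v ≤ x × u - v ≤ x

HasMatchingWeights : Graph → (u v : ℝ) → Set
HasMatchingWeights C u v =
  (d C V₁ V₂ ≈ v × d C V₃ V₄ ≈ v) ×
  (d C V₂ V₃ ≈ u - v × d C V₁ V₄ ≈ u - v) ×
  (d C V₁ V₃ ≈ - u × d C V₂ V₄ ≈ - u)

-- The three perfect matchings partition the six edges, so every weight of `C` is one of the three
-- bounded values.
allMatchings≤⇒edges≤ : ∀ C u v x → HasMatchingWeights C u v → AllMatchings≤ u v x →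
  ∀ i k → i ≢ k → d C i k ≤ x
allMatchings≤⇒edges≤ C u v x ((e₁₂ , e₃₄) , (e₂₃ , e₁₄) , (e₁₃ , e₂₄)) (-u≤x , v≤x , u-v≤x) = below
  where
    edge : ∀ i k w → d C i k ≈ w → w ≤ x → d C i k ≤ x
    edge i k w e w≤x = begin
      d C i k  ≈⟨ e ⟩
      w        ≲⟨ w≤x ⟩
      x        ∎

    edge′ : ∀ i k w → d C i k ≈ w → w ≤ x → d C k i ≤ x
    edge′ i k w e w≤x = begin
      d C k i  ≈⟨ d-sym C k i ⟩
      d C i k  ≲⟨ edge i k w e w≤x ⟩
      x        ∎

    below : ∀ i k → i ≢ k → d C i k ≤ x
    below 0F 0F 0≢0 = contradiction refl 0≢0
    below 0F 1F _ = edge V₁ V₂ v e₁₂ v≤x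
    below 0F 2F _ = edge V₁ V₃ (- u) e₁₃ -u≤x
    below 0F 3F _ = edge V₁ V₄ (u - v) e₁₄ u-v≤x
    below 1F 0F _ = edge′ V₁ V₂ v e₁₂ v≤x
    below 1F 1F 1≢1 = contradiction refl 1≢1
    below 1F 2F _ = edge V₂ V₃ (u - v) e₂₃ u-v≤x
    below 1F 3F _ = edge V₂ V₄ (- u) e₂₄ -u≤x
    below 2F 0F _ = edge′ V₁ V₃ (- u) e₁₃ -u≤x
    below 2F 1F _ = edge′ V₂ V₃ (u - v) e₂₃ u-v≤x
    below 2F 2F 2≢2 = contradiction refl 2≢2
    below 2F 3F _ = edge V₃ V₄ v e₃₄ v≤x
    below 3F 0F _ = edge′ V₁ V₄ (u - v) e₁₄ u-v≤x
    below 3F 1F _ = edge′ V₂ V₄ (- u) e₂₄ -u≤x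
    below 3F 2F _ = edge′ V₃ V₄ v e₃₄ v≤x
    below 3F 3F 3≢3 = contradiction refl 3≢3

OppositeEdges≤ : Graph → (Fin 4 → ℝ) → Set
OppositeEdges≤ H ω = ∀ i j k → i ≢ j → j ≢ k → i ≢ k → d H i k ≤ ω j

-- The three edges avoiding `j` form the triangle on the other vertices and lie one in each
-- matching, so their weights are exactly the three values to be bounded.
oppositeEdges≤⇒allMatchings≤ : ∀ C u v ω → HasMatchingWeights C u v → OppositeEdges≤ C ω →
  ∀ j → AllMatchings≤ u v (ω j)
oppositeEdges≤⇒allMatchings≤ C u v ω ((e₁₂ , e₃₄) , (e₂₃ , e₁₄) , (e₁₃ , e₂₄)) h = above
  where
    opposite : ∀ i j k w → d C i k ≈ w → i ≢ j → j ≢ k → i ≢ k → w ≤ ω j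
    opposite i j k w e i≢j j≢k i≢k = begin
      w        ≈⟨ e ⟨
      d C i k  ≲⟨ h i j k i≢j j≢k i≢k ⟩
      ω j      ∎

    above : ∀ j → AllMatchings≤ u v (ω j)
    above 0F = opposite V₂ V₁ V₄ (- u) e₂₄ (λ ()) (λ ()) (λ ())
             , opposite V₃ V₁ V₄ v e₃₄ (λ ()) (λ ()) (λ ())
             , opposite V₂ V₁ V₃ (u - v) e₂₃ (λ ()) (λ ()) (λ ())
    above 1F = opposite V₁ V₂ V₃ (- u) e₁₃ (λ ()) (λ ()) (λ ())
             , opposite V₃ V₂ V₄ v e₃₄ (λ ()) (λ ()) (λ ())
             , opposite V₁ V₂ V₄ (u - v) e₁₄ (λ ()) (λ ()) (λ ())
    above 2F = opposite V₂ V₃ V₄ (- u) e₂₄ (λ ()) (λ ()) (λ ())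
             , opposite V₁ V₃ V₂ v e₁₂ (λ ()) (λ ()) (λ ())
             , opposite V₁ V₃ V₄ (u - v) e₁₄ (λ ()) (λ ()) (λ ())
    above 3F = opposite V₁ V₄ V₃ (- u) e₁₃ (λ ()) (λ ()) (λ ())
             , opposite V₁ V₄ V₂ v e₁₂ (λ ()) (λ ()) (λ ())
             , opposite V₂ V₄ V₃ (u - v) e₂₃ (λ ()) (λ ()) (λ ())

allMatchings≤⇒0≤ : ∀ u v x → AllMatchings≤ u v x → 0ℝ ≤ x
allMatchings≤⇒0≤ u v x (-u≤x , v≤x , u-v≤x) =
  upper-bound-of-zero-sum (- u) v (u - v) x
    (λ n → solve 2 (λ u v → :- u :+ v :+ (u :- v) := con 0ℚ) refl (seq u n) (seq v n))
    -u≤x v≤x u-v≤x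

-- Triangle inequalities

decomposed-weight : ∀ G Gcpi C ω → HasVertexWeights Gcpi ω → C ≋ G -ᴳ Gcpi →
  ∀ i j → i ≢ j → d G i j ≈ (ω i + ω j) + d C i j
decomposed-weight G Gcpi C ω weights C≋ i j i≢j =
  ≈-trans g (p + (g - p)) (ω i + ω j + d C i j)
    (≈-pointwise {g} {p + (g - p)} λ n →
      solve 2 (λ g p → g := p :+ (g :- p)) refl (seq g n) (seq p n))
    (+-cong {p} {ω i + ω j} {g - p} {d C i j} (weights i j i≢j) (≈-sym (d C i j) (g - p) (C≋ i j)))
  where
    g = d G i j
    p = d Gcpi i j

-- The end weights `a` and `c` cancel, leaving `b + b` plus `q + r - p`; the zero sum turns the
-- latter into `- (p + p)`.
triangle-slack : ∀ {a b c p q r} → q ℚ.+ r ℚ.+ p ≡ 0ℚ →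
  ((a ℚ.+ b ℚ.+ q) ℚ.+ (b ℚ.+ c ℚ.+ r)) ℚ.- (a ℚ.+ c ℚ.+ p) ≡ (b ℚ.+ b) ℚ.- (p ℚ.+ p)
triangle-slack {a} {b} {c} {p} {q} {r} sum≡0 = trans
  (solve 6 (λ a b c p q r →
    ((a :+ b :+ q) :+ (b :+ c :+ r)) :- (a :+ c :+ p) :=
    ((b :+ b) :- (p :+ p)) :+ (q :+ r :+ p)) refl a b c p q r)
  (trans (cong ((b ℚ.+ b) ℚ.- (p ℚ.+ p) ℚ.+_) sum≡0) (ℚ.+-identityʳ _))

triangle⇔oppositeEdges≤ : ∀ G C ω → TriangleSumsVanish C →
  (∀ i j → i ≢ j → d G i j ≈ (ω i + ω j) + d C i j) →
  TriangleInequality G ⇔ OppositeEdges≤ C ω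
triangle⇔oppositeEdges≤ G C ω sumC weight = mk⇔
  -- By the slack identity, the triangle inequality is twice the wanted bound; the factor 2 is then
  -- cancelled. The converse doubles the bound and applies the identity backwards.
  (λ triangle i j k i≢j j≢k i≢k → double-cancel-≤ (d C i k) (ω j)
    (≤-resp-difference (w i k) (w i j + w j k) (d C i k + d C i k) (ω j + ω j)
      (slack i j k i≢j j≢k i≢k) (begin
        w i k              ≈⟨ weight i k i≢k ⟨
        d G i k            ≲⟨ triangle i j k i≢j j≢k i≢k ⟩
        d G i j + d G j k  ≈⟨ path i j k i≢j j≢k ⟩
        w i j + w j k      ∎)))
  (λ opposite i j k i≢j j≢k i≢k → begin
    d G i k            ≈⟨ weight i k i≢k ⟩
    w i k              ≲⟨ ≤-resp-difference (d C i k + d C i k) (ω j + ω j) (w i k) (w i j + w j k)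
                            (λ n → sym (slack i j k i≢j j≢k i≢k n))
                            (+-mono-≤ (d C i k) (ω j) (d C i k) (ω j)
                              (opposite i j k i≢j j≢k i≢k) (opposite i j k i≢j j≢k i≢k)) ⟩
    w i j + w j k      ≈⟨ path i j k i≢j j≢k ⟨
    d G i j + d G j k  ∎)
  where
    w : Fin 4 → Fin 4 → ℝ
    w i j = (ω i + ω j) + d C i j

    path : ∀ i j k → i ≢ j → j ≢ k → d G i j + d G j k ≈ w i j + w j k
    path i j k i≢j j≢k =
      +-cong {d G i j} {w i j} {d G j k} {w j k} (weight i j i≢j) (weight j k j≢k)

    slack : ∀ i j k → i ≢ j → j ≢ k → i ≢ k →
      ∀ n → seq ((w i j + w j k) - w i k) n ≡ seq ((ω j + ω j) - (d C i k + d C i k)) n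
    slack i j k i≢j j≢k i≢k n = triangle-slack
      {seq (ω i) n} {seq (ω j) n} {seq (ω k) n} {seq (d C i k) n} {seq (d C i j) n} {seq (d C j k) n}
      (sumC i j k i≢j j≢k i≢k n)

theorem17 : (G Gcpi Gcyclic : Graph) (ω : Fin 4 → ℝ) (u v : ℝ) →
    IsOrthogonalProjection IsCPI G Gcpi →
    Gcyclic ≋ G -ᴳ Gcpi →
    HasVertexWeights Gcpi ω →
    Gcyclic ≋ u ·ᴳ 𝐛 V₁ V₄ V₂ V₃ +ᴳ v ·ᴳ 𝐛 V₁ V₂ V₃ V₄ →
    (TriangleInequality G ⇔ (min₄ ω ≥ - u × min₄ ω ≥ v × min₄ ω ≥ u - v)) ×
    ((∃[ j ] ω j < 0ℝ) → ¬ TriangleInequality G)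
theorem17 G Gcpi Gcyclic ω u v _ cyclic≋ weights cyclic≋C =
  mk⇔ (below-min ∘ triangle⇒) ⇒triangle ,
  -- The triangle inequality puts all three matching values below this particular `ω j`, and as they
  -- sum to zero it cannot be negative.
  λ (j , ωj<0) triangle → ≤⇒≯ 0ℝ (ω j) (allMatchings≤⇒0≤ u v (ω j) (triangle⇒ triangle j)) ωj<0
  where
    -- The explicit combination replaces `Gcyclic`, which agrees with it only up to `_≈_`, because
    -- its triangle sums vanish termwise.
    C = cyclicGraph u v

    C≋ : C ≋ G -ᴳ Gcpi
    C≋ i j = ≈-trans (d C i j) (d Gcyclic i j) (d (G -ᴳ Gcpi) i j)
      (≈-sym (d Gcyclic i j) (d C i j) (cyclic≋C i j)) (cyclic≋ i j)

    open Equivalence (triangle⇔oppositeEdges≤ G C ω (cyclicGraph-triangleSum u v)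
      (decomposed-weight G Gcpi C ω weights C≋))

    triangle⇒ : TriangleInequality G → ∀ j → AllMatchings≤ u v (ω j)
    triangle⇒ triangle = oppositeEdges≤⇒allMatchings≤ C u v ω (cyclicGraph-weights u v) (to triangle)

    below-min : (∀ j → AllMatchings≤ u v (ω j)) → AllMatchings≤ u v (min₄ ω)
    below-min h = min₄-glb ω (- u) (λ j → let (p , _ , _) = h j in p)
                , min₄-glb ω v (λ j → let (_ , p , _) = h j in p)
                , min₄-glb ω (u - v) (λ j → let (_ , _ , p) = h j in p)

    ⇒triangle : AllMatchings≤ u v (min₄ ω) → TriangleInequality G
    ⇒triangle h = from λ i j k i≢j j≢k i≢k → begin
      d C i k  ≲⟨ allMatchings≤⇒edges≤ C u v (min₄ ω) (cyclicGraph-weights u v) h i k i≢k ⟩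
      min₄ ω   ≲⟨ min₄≤ ω j ⟩
      ω j      ∎
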